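{- Let $G=\langle V,A\rangle$ be a finite directed graph with $n$ vertices such that $N^+(v)=\{u\mid vu\in A\}$ is nonempty for every $v\in V$. Let $N^+[v]=N^+(v)\cup\{v\}$. Let $L:V\to\{1,\dots,n\}$ be a bijective labelling chosen uniformly at random among all $n!$ labellings, and for $v\in V$ let $r_L(v)=\operatorname{argmin}_{w\in N^+[v]}L(w)$. Then $\mathbb{E}\bigl(|\{r_L(v)\mid v\in V\}|\bigr)\le \tfrac23 n$. Moreover, this bound is tight: for the directed 3-cycle equality holds. -}

module Defs where

open import Data.Bool using (Bool; true; false; _∧_; _∨_; if_then_else_; not)
open import Data.Nat using (ℕ; zero; suc; _<ᵇ_)
open import Data.Fin using (Fin; toℕ)
open import Data.Fin.Properties using (_≟_)
open import Data.List using (List; []; _∷_; map; concatMap; foldr; filterᵇ; length)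
open import Data.Bool.ListAction using (any; all)
open import Data.Nat.ListAction using (sum)
open import Data.List using () renaming ([_] to singleton)
open import Data.Vec.Functional using () renaming (_∷_ to _◂_)
open import Data.Product using (∃)
open import Relation.Binary.PropositionalEquality using (_≡_)
open import Relation.Nullary.Decidable using (⌊_⌋)

open import Data.List using (allFin) public

-- A finite directed graph on the vertex set Fin n, given by its arc relation
-- (arc v u ≡ true  iff  vu ∈ A).
record Digraph (n : ℕ) : Set where
  field
    arc : Fin n → Fin n → Bool
open Digraph public

_==_ : ∀ {n} → Fin n → Fin n → Bool
i == j = ⌊ i ≟ j ⌋

-- Digraphs are loopless (an arc vv is not an arc of a directed graph).
Loopless : ∀ {n} → Digraph n → Set
Loopless {n} G = (v : Fin n) → arc G v v ≡ false

OutNonempty : ∀ {n} → Digraph n → Set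
OutNonempty {n} G = (v : Fin n) → ∃ λ (u : Fin n) → arc G v u ≡ true

inClosedNbr : ∀ {n} → Digraph n → Fin n → Fin n → Bool
inClosedNbr G v w = (w == v) ∨ arc G v w

allFuns : (n m : ℕ) → List (Fin n → Fin m)
allFuns zero    m = singleton (λ ())
allFuns (suc n) m = concatMap (λ f → map (λ k → k ◂ f) (allFin m)) (allFuns n m)

isInjectiveᵇ : ∀ {n m} → (Fin n → Fin m) → Bool
isInjectiveᵇ {n} f =
  all (λ i → all (λ j → not (f i == f j) ∨ (i == j)) (allFin n)) (allFin n)

-- All bijective labellings L : V → {1,…,n}, with labels encoded as Fin n
-- (label k+1 represented by k; argmin is unaffected by this shift).
labellings : (n : ℕ) → List (Fin n → Fin n)
labellings n = filterᵇ isInjectiveᵇ (allFuns n n)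

r : ∀ {n} → Digraph n → (Fin n → Fin n) → Fin n → Fin n
r {n} G L v =
  foldr (λ w b → if inClosedNbr G v w ∧ (toℕ (L w) <ᵇ toℕ (L b)) then w else b)
        v (allFin n)

imageSize : ∀ {n} → Digraph n → (Fin n → Fin n) → ℕ
imageSize {n} G L =
  length (filterᵇ (λ w → any (λ v → r G L v == w) (allFin n)) (allFin n))

-- Sum over all n! labellings of |{ r_L(v) | v ∈ V }|;
-- the expectation under the uniform labelling is  totalImage G / n!.
totalImage : ∀ {n} → Digraph n → ℕ
totalImage {n} G = sum (map (imageSize G) (labellings n))

cycle3 : Digraph 3
cycle3 = record { arc = λ v u → step v == u }
  where
  step : Fin 3 → Fin 3
  step Fin.zero = Fin.suc Fin.zero
  step (Fin.suc Fin.zero) = Fin.suc (Fin.suc Fin.zero)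
  step (Fin.suc (Fin.suc Fin.zero)) = Fin.zero

{-# OPTIONS --safe #-}
module Submission where

-- Fix an out-neighbour f(v) of every v. If w lies in the image of r_L and L(f w) < L(w),
-- then w = r_L(v) for some arc vw, so
--   |image| + #{w : L(f w) < L(w)} ≤ n + #{(v,w) : vw ∈ A, w = r_L(v), L(f w) < L(w)}.
-- The second term has expectation n/2. If v has outdegree d, the pair (v,w) contributes
-- at most 1/(d+1) − 1/(d+2) to the last one, so v contributes at most d/((d+1)(d+2)) ≤ 1/6.

open import Defs
open import Data.Nat using (ℕ; _*_; _≤_)
open import Data.Nat using (_!)
open import Data.Product using (_×_)
open import Relation.Binary.PropositionalEquality using (_≡_)

open import Data.Bool using (Bool; true; false; T; _∧_; _∨_; not; if_then_else_)
open import Data.Bool.ListAction using (any)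
open import Data.Bool.Properties using (T?; T-∨)
open import Data.Empty using (⊥-elim)
open import Data.Fin as Fin using (Fin; toℕ)
open import Data.Fin.Permutation.Components using (transpose; transpose-inverse)
open import Data.Fin.Properties using (_≟_; all?; any?)
import Data.Fin.Properties as Finₚ
open import Data.List using (List; []; _∷_; map; concatMap; foldr; filterᵇ; length; tabulate; _++_)
open import Data.List.Membership.Propositional using (_∈_; find; lose)
open import Data.List.Membership.Propositional.Properties using (∈-allFin)
open import Data.List.Properties using (map-tabulate; length-tabulate; map-∘)
open import Data.List.Relation.Unary.All as All using (All; []; _∷_)
open import Data.List.Relation.Unary.All.Properties using (all⁺; all⁻; all-filter)
open import Data.List.Relation.Unary.Any using (here; there)
open import Data.List.Relation.Unary.Any.Properties using (any⁻)
open import Data.Nat using (zero; suc; _+_; _∸_; _<_; _<?_; _<ᵇ_; z≤n)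
open import Data.Nat.ListAction using (sum)
open import Data.Nat.Properties hiding (_≟_)
open import Data.Nat.Tactic.RingSolver using (solve-∀)
open import Data.Product using (∃; _,_; proj₁; proj₂)
open import Data.Sum using (_⊎_; inj₁; inj₂)
open import Data.Unit using (tt)
open import Data.Vec.Functional using () renaming (_∷_ to _◂_)
open import Function using (_∘_; Equivalence)
open import Relation.Binary.PropositionalEquality
  using (refl; sym; trans; cong; cong₂; subst; _≗_; _≢_; module ≡-Reasoning)
open import Relation.Nullary using (Dec; yes; no; does; ¬_; contradiction)
open import Relation.Nullary.Decidable
  using (map′; _×-dec_; _→-dec_; toWitness; fromWitness)

private
  variable
    A B : Set
    P Q : Set
    m n : ℕ

-- Indicators and finite sums.

𝟙 : Dec P → ℕ
𝟙 P? = if does P? then 1 else 0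

𝟙≤1 : (P? : Dec P) → 𝟙 P? ≤ 1
𝟙≤1 (yes _) = ≤-refl
𝟙≤1 (no _)  = z≤n

𝟙-yes : (P? : Dec P) → P → 𝟙 P? ≡ 1
𝟙-yes (yes _) p = refl
𝟙-yes (no ¬p) p = contradiction p ¬p

𝟙-no : (P? : Dec P) → ¬ P → 𝟙 P? ≡ 0
𝟙-no (yes p) ¬p = contradiction p ¬p
𝟙-no (no _)  ¬p = refl

𝟙-cong : (P? : Dec P) (Q? : Dec Q) → (P → Q) → (Q → P) → 𝟙 P? ≡ 𝟙 Q?
𝟙-cong (yes p) Q? f g = sym (𝟙-yes Q? (f p))
𝟙-cong (no ¬p) Q? f g = sym (𝟙-no Q? (¬p ∘ g))

𝟙-× : (P? : Dec P) (Q? : Dec Q) → 𝟙 (P? ×-dec Q?) ≡ 𝟙 P? * 𝟙 Q?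
𝟙-× (yes _) (yes _) = refl
𝟙-× (yes _) (no _)  = refl
𝟙-× (no _)  _       = refl

∑ : List A → (A → ℕ) → ℕ
∑ xs F = sum (map F xs)

infix 5 ∑
syntax ∑ xs (λ x → e) = ∑[ x ← xs ] e

∑-cong-All : {F G : A → ℕ} {xs : List A} → All (λ x → F x ≡ G x) xs → ∑ xs F ≡ ∑ xs G
∑-cong-All []         = refl
∑-cong-All (eq ∷ eqs) = cong₂ _+_ eq (∑-cong-All eqs)

∑-mono-All : {F G : A → ℕ} {xs : List A} → All (λ x → F x ≤ G x) xs → ∑ xs F ≤ ∑ xs G
∑-mono-All []         = z≤n
∑-mono-All (le ∷ les) = +-mono-≤ le (∑-mono-All les)

∑-cong : (xs : List A) {F G : A → ℕ} → (∀ x → F x ≡ G x) → ∑ xs F ≡ ∑ xs G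
∑-cong xs eq = ∑-cong-All (All.universal eq xs)

∑-mono : (xs : List A) {F G : A → ℕ} → (∀ x → F x ≤ G x) → ∑ xs F ≤ ∑ xs G
∑-mono xs le = ∑-mono-All (All.universal le xs)

∑-const : (xs : List A) (c : ℕ) → (∑[ _ ← xs ] c) ≡ length xs * c
∑-const []       c = refl
∑-const (x ∷ xs) c = cong (c +_) (∑-const xs c)

∑-zero : (xs : List A) → (∑[ _ ← xs ] 0) ≡ 0
∑-zero xs = trans (∑-const xs 0) (*-zeroʳ (length xs))

∑-+ : (xs : List A) (F G : A → ℕ) → (∑[ x ← xs ] (F x + G x)) ≡ ∑ xs F + ∑ xs G
∑-+ []       F G = refl
∑-+ (x ∷ xs) F G rewrite ∑-+ xs F G = interchange (F x) (G x) (∑ xs F) (∑ xs G)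
  where
  interchange : ∀ a b c d → (a + b) + (c + d) ≡ (a + c) + (b + d)
  interchange = solve-∀

∑-*ˡ : (xs : List A) (c : ℕ) (F : A → ℕ) → (∑[ x ← xs ] (c * F x)) ≡ c * ∑ xs F
∑-*ˡ []       c F = sym (*-zeroʳ c)
∑-*ˡ (x ∷ xs) c F rewrite ∑-*ˡ xs c F = sym (*-distribˡ-+ c (F x) (∑ xs F))

∑-*ʳ : (xs : List A) (c : ℕ) (F : A → ℕ) → (∑[ x ← xs ] (F x * c)) ≡ ∑ xs F * c
∑-*ʳ []       c F = refl
∑-*ʳ (x ∷ xs) c F rewrite ∑-*ʳ xs c F = sym (*-distribʳ-+ c (F x) (∑ xs F))

∑-swap : (xs : List A) (ys : List B) (F : A → B → ℕ) →
         (∑[ x ← xs ] ∑[ y ← ys ] F x y) ≡ (∑[ y ← ys ] ∑[ x ← xs ] F x y)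
∑-swap []       ys F = sym (∑-zero ys)
∑-swap (x ∷ xs) ys F rewrite ∑-swap xs ys F = sym (∑-+ ys (F x) _)

∑-map : (h : A → B) (xs : List A) (F : B → ℕ) → ∑ (map h xs) F ≡ ∑ xs (F ∘ h)
∑-map h xs F = cong sum (sym (map-∘ xs))

∑-++ : (xs ys : List A) (F : A → ℕ) → ∑ (xs ++ ys) F ≡ ∑ xs F + ∑ ys F
∑-++ []       ys F = refl
∑-++ (x ∷ xs) ys F rewrite ∑-++ xs ys F = sym (+-assoc (F x) (∑ xs F) (∑ ys F))

∑-concatMap : (h : A → List B) (xs : List A) (F : B → ℕ) →
              ∑ (concatMap h xs) F ≡ (∑[ x ← xs ] ∑ (h x) F)
∑-concatMap h []       F = refl
∑-concatMap h (x ∷ xs) F =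
  trans (∑-++ (h x) (concatMap h xs) F) (cong (∑ (h x) F +_) (∑-concatMap h xs F))

∑-filterᵇ : (p : A → Bool) (xs : List A) (F : A → ℕ) →
            ∑ (filterᵇ p xs) F ≡ (∑[ x ← xs ] (𝟙 (T? (p x)) * F x))
∑-filterᵇ p []       F = refl
∑-filterᵇ p (x ∷ xs) F with p x
... | true  = cong₂ _+_ (sym (*-identityˡ (F x))) (∑-filterᵇ p xs F)
... | false = ∑-filterᵇ p xs F

length-filterᵇ : (p : A → Bool) (xs : List A) →
                 length (filterᵇ p xs) ≡ (∑[ x ← xs ] 𝟙 (T? (p x)))
length-filterᵇ p []       = refl
length-filterᵇ p (x ∷ xs) with p x
... | true  = cong suc (length-filterᵇ p xs)
... | false = length-filterᵇ p xs

∑-∈ : {xs : List A} {x : A} (F : A → ℕ) → x ∈ xs → F x ≤ ∑ xs F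
∑-∈ F (here refl) = m≤m+n _ _
∑-∈ F (there x∈)  = m≤n⇒m≤o+n _ (∑-∈ F x∈)

-- Sums over `Fin n`.

∑-allFin-suc : (F : Fin (suc n) → ℕ) →
               ∑ (allFin (suc n)) F ≡ F Fin.zero + ∑ (allFin n) (F ∘ Fin.suc)
∑-allFin-suc {n} F = cong (F Fin.zero +_) (begin
  sum (map F (tabulate Fin.suc))  ≡⟨ cong sum (map-tabulate Fin.suc F) ⟩
  sum (tabulate (F ∘ Fin.suc))    ≡⟨ cong sum (map-tabulate (λ i → i) (F ∘ Fin.suc)) ⟨
  ∑ (allFin n) (F ∘ Fin.suc)                ∎)
  where open ≡-Reasoning

∑-allFin-const : (c : ℕ) → (∑[ _ ← allFin n ] c) ≡ n * c
∑-allFin-const {n} c = trans (∑-const (allFin n) c) (cong (_* c) (length-tabulate {n = n} (λ i → i)))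

∑-δ : (i : Fin n) (F : Fin n → ℕ) → (∑[ j ← allFin n ] (𝟙 (i ≟ j) * F j)) ≡ F i
∑-δ {suc n} Fin.zero F = begin
  (∑[ j ← allFin (suc n) ] (𝟙 (Fin.zero ≟ j) * F j))
    ≡⟨ ∑-allFin-suc (λ j → 𝟙 (Fin.zero ≟ j) * F j) ⟩
  1 * F Fin.zero + (∑[ _ ← allFin n ] 0)
    ≡⟨ cong₂ _+_ (*-identityˡ (F Fin.zero)) (∑-zero (allFin n)) ⟩
  F Fin.zero + 0
    ≡⟨ +-identityʳ _ ⟩
  F Fin.zero ∎
  where open ≡-Reasoning
∑-δ {suc n} (Fin.suc i) F = begin
  (∑[ j ← allFin (suc n) ] (𝟙 (Fin.suc i ≟ j) * F j))
    ≡⟨ ∑-allFin-suc (λ j → 𝟙 (Fin.suc i ≟ j) * F j) ⟩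
  (∑[ j ← allFin n ] (𝟙 (Fin.suc i ≟ Fin.suc j) * F (Fin.suc j)))
    ≡⟨ ∑-cong (allFin n) (λ j → cong (_* F (Fin.suc j))
         (𝟙-cong (Fin.suc i ≟ Fin.suc j) (i ≟ j) Finₚ.suc-injective (cong Fin.suc))) ⟩
  (∑[ j ← allFin n ] (𝟙 (i ≟ j) * F (Fin.suc j)))
    ≡⟨ ∑-δ i (F ∘ Fin.suc) ⟩
  F (Fin.suc i) ∎
  where open ≡-Reasoning

-- Turns existence and uniqueness of a witness into a count. It is applied to the position of a
-- value under an injective map and to the minimiser of a labelling.
∑-unique : {R : Fin n → Set} (R? : ∀ j → Dec (R j)) (i : Fin n) →
           R i → (∀ j → R j → i ≡ j) → (∑[ j ← allFin n ] 𝟙 (R? j)) ≡ 1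
∑-unique {n} R? i Ri uniq = begin
  (∑[ j ← allFin n ] 𝟙 (R? j))
    ≡⟨ ∑-cong (allFin n) (λ j → trans
         (𝟙-cong (R? j) (i ≟ j) (uniq j) (λ { refl → Ri }))
         (sym (*-identityʳ (𝟙 (i ≟ j))))) ⟩
  (∑[ j ← allFin n ] (𝟙 (i ≟ j) * 1))
    ≡⟨ ∑-δ i (λ _ → 1) ⟩
  1 ∎
  where open ≡-Reasoning

-- Sums over all functions between finite sets.

-- Function extensionality is not available, so identities between sums over
-- functions are restricted to summands that respect pointwise equality.
Extensional : ((Fin n → Fin m) → ℕ) → Set
Extensional F = ∀ {f g} → f ≗ g → F f ≡ F g

_≗?_ : (f g : Fin n → Fin m) → Dec (f ≗ g)
f ≗? g = all? (λ i → f i ≟ g i)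

∑-allFuns-suc : (F : (Fin (suc n) → Fin m) → ℕ) →
                ∑ (allFuns (suc n) m) F ≡ (∑[ f ← allFuns n m ] ∑[ k ← allFin m ] F (k ◂ f))
∑-allFuns-suc {n} {m} F = trans
  (∑-concatMap (λ f → map (λ k → k ◂ f) (allFin m)) (allFuns n m) F)
  (∑-cong (allFuns n m) (λ f → ∑-map (_◂ f) (allFin m) F))

◂-cong : (k : Fin m) {f g : Fin n → Fin m} → f ≗ g → (k ◂ f) ≗ (k ◂ g)
◂-cong k f≗g Fin.zero    = refl
◂-cong k f≗g (Fin.suc i) = f≗g i

-- The enumeration meets every function exactly once up to pointwise equality. In the induction the
-- value at zero and the remaining values are matched separately.
∑-allFuns-δ : (f : Fin n → Fin m) {F : (Fin n → Fin m) → ℕ} → Extensional F →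
              (∑[ g ← allFuns n m ] (𝟙 (f ≗? g) * F g)) ≡ F f
-- The only entry of `allFuns zero m` is an absurd lambda, which cannot be written down again as the
-- same term; `at` covers whatever function stands there.
∑-allFuns-δ {zero} f {F} ext = at _
  where
  at : ∀ g → 𝟙 (f ≗? g) * F g + 0 ≡ F f
  at g = trans (+-identityʳ _) (trans (cong (_* F g) (𝟙-yes (f ≗? g) (λ ())))
           (trans (*-identityˡ (F g)) (ext (λ ()))))
∑-allFuns-δ {suc n} {m} f {F} ext = begin
  (∑[ g ← allFuns (suc n) m ] (𝟙 (f ≗? g) * F g))
    ≡⟨ ∑-allFuns-suc (λ g → 𝟙 (f ≗? g) * F g) ⟩
  (∑[ g ← allFuns n m ] ∑[ k ← allFin m ] (𝟙 (f ≗? (k ◂ g)) * F (k ◂ g)))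
    ≡⟨ ∑-cong (allFuns n m) (λ g → trans
         (∑-cong (allFin m) (λ k → split g k))
         (∑-*ˡ (allFin m) (𝟙 (tail ≗? g)) (λ k → 𝟙 (head ≟ k) * F (k ◂ g)))) ⟩
  (∑[ g ← allFuns n m ] (𝟙 (tail ≗? g) * (∑[ k ← allFin m ] (𝟙 (head ≟ k) * F (k ◂ g)))))
    ≡⟨ ∑-cong (allFuns n m) (λ g → cong (𝟙 (tail ≗? g) *_) (∑-δ head (λ k → F (k ◂ g)))) ⟩
  (∑[ g ← allFuns n m ] (𝟙 (tail ≗? g) * F (head ◂ g)))
    ≡⟨ ∑-allFuns-δ tail (λ g≗h → ext (◂-cong head g≗h)) ⟩
  F (head ◂ tail)
    ≡⟨ ext (λ { Fin.zero → refl ; (Fin.suc i) → refl }) ⟩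
  F f ∎
  where
  open ≡-Reasoning
  head = f Fin.zero
  tail = f ∘ Fin.suc
  split : ∀ g k → 𝟙 (f ≗? (k ◂ g)) * F (k ◂ g) ≡ 𝟙 (tail ≗? g) * (𝟙 (head ≟ k) * F (k ◂ g))
  split g k = begin
    𝟙 (f ≗? (k ◂ g)) * F (k ◂ g)
      ≡⟨ cong (_* F (k ◂ g)) (𝟙-cong (f ≗? (k ◂ g)) ((tail ≗? g) ×-dec (head ≟ k))
           (λ eq → eq ∘ Fin.suc , eq Fin.zero)
           (λ { (eq , eq₀) Fin.zero → eq₀ ; (eq , eq₀) (Fin.suc i) → eq i })) ⟩
    𝟙 ((tail ≗? g) ×-dec (head ≟ k)) * F (k ◂ g)
      ≡⟨ cong (_* F (k ◂ g)) (𝟙-× (tail ≗? g) (head ≟ k)) ⟩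
    𝟙 (tail ≗? g) * 𝟙 (head ≟ k) * F (k ◂ g)
      ≡⟨ *-assoc (𝟙 (tail ≗? g)) (𝟙 (head ≟ k)) (F (k ◂ g)) ⟩
    𝟙 (tail ≗? g) * (𝟙 (head ≟ k) * F (k ◂ g)) ∎

-- Expand `F (f ∘ σ)` as a sum over `g` of delta terms and swap the sums. Since `f ∘ σ` agrees with
-- `g` exactly when `g ∘ τ` agrees with `f`, each `g` is then hit by exactly one `f`.
∑-allFuns-reindex : (σ τ : Fin n → Fin n) → (∀ i → σ (τ i) ≡ i) → (∀ i → τ (σ i) ≡ i) →
                    {F : (Fin n → Fin m) → ℕ} → Extensional F →
                    (∑[ f ← allFuns n m ] F (f ∘ σ)) ≡ ∑ (allFuns n m) F
∑-allFuns-reindex {n} {m} σ τ στ τσ {F} ext = begin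
  (∑[ f ← fs ] F (f ∘ σ))
    ≡⟨ ∑-cong fs (λ f → ∑-allFuns-δ (f ∘ σ) ext) ⟨
  (∑[ f ← fs ] ∑[ g ← fs ] (𝟙 ((f ∘ σ) ≗? g) * F g))
    ≡⟨ ∑-swap fs fs (λ f g → 𝟙 ((f ∘ σ) ≗? g) * F g) ⟩
  (∑[ g ← fs ] ∑[ f ← fs ] (𝟙 ((f ∘ σ) ≗? g) * F g))
    ≡⟨ ∑-cong fs (λ g → ∑-cong fs (λ f → cong (_* F g) (𝟙-cong ((f ∘ σ) ≗? g) ((g ∘ τ) ≗? f)
         (λ eq i → trans (sym (eq (τ i))) (cong f (στ i)))
         (λ eq i → trans (sym (eq (σ i))) (cong g (τσ i)))))) ⟩
  (∑[ g ← fs ] ∑[ f ← fs ] (𝟙 ((g ∘ τ) ≗? f) * F g))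
    ≡⟨ ∑-cong fs (λ g → ∑-allFuns-δ (g ∘ τ) {λ _ → F g} (λ _ → refl)) ⟩
  ∑ fs F ∎
  where
  open ≡-Reasoning
  fs = allFuns n m

-- Labellings and their invariance under permutations.

Injective : (Fin n → Fin m) → Set
Injective f = ∀ i j → f i ≡ f j → i ≡ j

isInjectiveᵇ⇒Injective : (f : Fin n → Fin m) → T (isInjectiveᵇ f) → Injective f
isInjectiveᵇ⇒Injective {n} f inj i j fi≡fj
  with Equivalence.to (T-∨ {not (f i == f j)} {i == j})
         (All.lookup (all⁺ _ (allFin n) (All.lookup (all⁺ _ (allFin n) inj) (∈-allFin i))) (∈-allFin j))
... | inj₂ i==j = toWitness i==j
... | inj₁ fi≠fj with f i ≟ f j
...   | yes _    = ⊥-elim fi≠fj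
...   | no fi≢fj = contradiction fi≡fj fi≢fj

Injective⇒isInjectiveᵇ : (f : Fin n → Fin m) → Injective f → T (isInjectiveᵇ f)
Injective⇒isInjectiveᵇ {n} f inj =
  all⁻ _ (All.universal (λ i → all⁻ _ (All.universal (λ j → entry i j) (allFin n))) (allFin n))
  where
  entry : ∀ i j → T (not (f i == f j) ∨ (i == j))
  entry i j with f i ≟ f j
  ... | no _      = tt
  ... | yes fi≡fj = fromWitness (inj i j fi≡fj)

-- Built on the Boolean test, so that its indicator computes to that of `T? (isInjectiveᵇ f)` and
-- sums over `labellings` unfold directly.
injective? : (f : Fin n → Fin m) → Dec (Injective f)
injective? f = map′ (isInjectiveᵇ⇒Injective f) (Injective⇒isInjectiveᵇ f) (T? (isInjectiveᵇ f))

∑-labellings : (F : (Fin n → Fin n) → ℕ) →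
               ∑ (labellings n) F ≡ (∑[ f ← allFuns n n ] (𝟙 (injective? f) * F f))
∑-labellings {n} F = ∑-filterᵇ isInjectiveᵇ (allFuns n n) F

labellings-injective : (n : ℕ) → All Injective (labellings n)
labellings-injective n =
  All.map (λ {f} → isInjectiveᵇ⇒Injective f) (all-filter (T? ∘ isInjectiveᵇ) (allFuns n n))

Injective-resp : {f g : Fin n → Fin m} → f ≗ g → Injective f → Injective g
Injective-resp f≗g inj i j gi≡gj = inj i j (trans (f≗g i) (trans gi≡gj (sym (f≗g j))))

-- Invariance of the uniform distribution under renaming vertices: composing with a permutation
-- neither creates nor destroys injectivity, so the indicator can be reindexed together with `F`.
∑-labellings-reindex : (σ τ : Fin n → Fin n) → (∀ i → σ (τ i) ≡ i) → (∀ i → τ (σ i) ≡ i) →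
                       {F : (Fin n → Fin n) → ℕ} → Extensional F →
                       (∑[ L ← labellings n ] F (L ∘ σ)) ≡ ∑ (labellings n) F
∑-labellings-reindex {n} σ τ στ τσ {F} ext = begin
  (∑[ L ← labellings n ] F (L ∘ σ))
    ≡⟨ ∑-labellings (λ L → F (L ∘ σ)) ⟩
  (∑[ f ← allFuns n n ] (𝟙 (injective? f) * F (f ∘ σ)))
    ≡⟨ ∑-cong (allFuns n n) (λ f → cong (_* F (f ∘ σ)) (𝟙-cong (injective? f) (injective? (f ∘ σ))
         (λ inj i j eq → trans (sym (τσ i)) (trans (cong τ (inj (σ i) (σ j) eq)) (τσ j)))
         (λ inj i j eq → trans (sym (στ i)) (trans (cong σ (inj (τ i) (τ j)
            (trans (cong f (στ i)) (trans eq (sym (cong f (στ j))))))) (στ j))))) ⟩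
  (∑[ f ← allFuns n n ] (𝟙 (injective? (f ∘ σ)) * F (f ∘ σ)))
    ≡⟨ ∑-allFuns-reindex σ τ στ τσ (λ {f} {g} f≗g → cong₂ _*_
         (𝟙-cong (injective? f) (injective? g) (Injective-resp f≗g) (Injective-resp (sym ∘ f≗g)))
         (ext f≗g)) ⟩
  (∑[ f ← allFuns n n ] (𝟙 (injective? f) * F f))
    ≡⟨ ∑-labellings F ⟨
  ∑ (labellings n) F ∎
  where open ≡-Reasoning

-- Counting injections.

#injections : ℕ → ℕ → ℕ
#injections n m = ∑[ f ← allFuns n m ] 𝟙 (injective? f)

-- A new first value must avoid the image of `f`, which has `n` elements if `f` is injective; a
-- non-injective `f` has no injective extension.
extensions-bound : (f : Fin n → Fin m) →
                   (∑[ k ← allFin m ] 𝟙 (injective? (k ◂ f))) ≤ 𝟙 (injective? f) * (m ∸ n)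
extensions-bound {n} {m} f with injective? f
... | no ¬inj = ≤-trans
  (≤-reflexive (trans
    (∑-cong (allFin m) (λ k → 𝟙-no (injective? (k ◂ f))
      (λ inj → ¬inj (λ i j eq → Finₚ.suc-injective (inj (Fin.suc i) (Fin.suc j) eq)))))
    (∑-zero (allFin m))))
  z≤n
... | yes inj = ≤-trans new≤m∸n (≤-reflexive (sym (trans
  (cong (_* (m ∸ n)) (𝟙-yes (injective? f) inj)) (*-identityˡ (m ∸ n)))))
  where
  open ≤-Reasoning
  new = ∑[ k ← allFin m ] 𝟙 (injective? (k ◂ f))

  -- A value already taken by `f` is taken exactly once and cannot be used again.
  new-or-old : ∀ k → 𝟙 (injective? (k ◂ f)) + (∑[ i ← allFin n ] 𝟙 (f i ≟ k)) ≤ 1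
  new-or-old k with any? (λ i → f i ≟ k)
  ... | yes (i , fi≡k) = ≤-reflexive (cong₂ _+_
    (𝟙-no (injective? (k ◂ f)) (λ inj′ → Finₚ.0≢1+n (inj′ Fin.zero (Fin.suc i) (sym fi≡k))))
    (∑-unique (λ i → f i ≟ k) i fi≡k (λ j fj≡k → inj i j (trans fi≡k (sym fj≡k)))))
  ... | no ∄i = begin
    𝟙 (injective? (k ◂ f)) + (∑[ i ← allFin n ] 𝟙 (f i ≟ k))
      ≡⟨ cong (𝟙 (injective? (k ◂ f)) +_)
           (trans (∑-cong (allFin n) (λ i → 𝟙-no (f i ≟ k) (λ eq → ∄i (i , eq)))) (∑-zero (allFin n))) ⟩
    𝟙 (injective? (k ◂ f)) + 0  ≡⟨ +-identityʳ _ ⟩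
    𝟙 (injective? (k ◂ f))      ≤⟨ 𝟙≤1 (injective? (k ◂ f)) ⟩
    1                           ∎

  new≤m∸n : new ≤ m ∸ n
  new≤m∸n = m+n≤o⇒m≤o∸n new (begin
    new + n
      ≡⟨ cong (new +_) (trans (sym (*-identityʳ n)) (sym (∑-allFin-const {n} 1))) ⟩
    new + (∑[ i ← allFin n ] 1)
      -- Double counting: each `i` has exactly one value, so `n` counts the pairs `(i , k)` with
      -- `f i ≡ k`, which are then grouped by `k`.
      ≡⟨ cong (new +_) (∑-cong (allFin n) (λ i → ∑-unique (λ k → f i ≟ k) (f i) refl (λ _ eq → eq))) ⟨
    new + (∑[ i ← allFin n ] ∑[ k ← allFin m ] 𝟙 (f i ≟ k))
      ≡⟨ cong (new +_) (∑-swap (allFin n) (allFin m) (λ i k → 𝟙 (f i ≟ k))) ⟩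
    new + (∑[ k ← allFin m ] ∑[ i ← allFin n ] 𝟙 (f i ≟ k))
      ≡⟨ ∑-+ (allFin m) _ _ ⟨
    (∑[ k ← allFin m ] (𝟙 (injective? (k ◂ f)) + (∑[ i ← allFin n ] 𝟙 (f i ≟ k))))
      ≤⟨ ∑-mono (allFin m) new-or-old ⟩
    (∑[ k ← allFin m ] 1)
      ≡⟨ trans (∑-allFin-const {m} 1) (*-identityʳ m) ⟩
    m ∎)

-- The falling factorial m!/(m - n)! with the denominator cleared. Each induction step adds one
-- value, with at most `m ∸ n` choices, and this factor is absorbed into the factorial.
#injections-bound : (n m : ℕ) → n ≤ m → #injections n m * (m ∸ n) ! ≤ m !
#injections-bound zero m n≤m =
  ≤-reflexive (trans (cong (_* m !) (∑-const (allFuns 0 m) 1)) (*-identityˡ (m !)))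
#injections-bound (suc n) m n<m = begin
  #injections (suc n) m * (m ∸ suc n) !
    ≡⟨ cong (_* (m ∸ suc n) !) (∑-allFuns-suc {n} {m} (λ f → 𝟙 (injective? f))) ⟩
  (∑[ f ← allFuns n m ] ∑[ k ← allFin m ] 𝟙 (injective? (k ◂ f))) * (m ∸ suc n) !
    ≤⟨ *-monoˡ-≤ ((m ∸ suc n) !) (∑-mono (allFuns n m) extensions-bound) ⟩
  (∑[ f ← allFuns n m ] (𝟙 (injective? f) * (m ∸ n))) * (m ∸ suc n) !
    ≡⟨ cong (_* (m ∸ suc n) !) (∑-*ʳ (allFuns n m) (m ∸ n) (λ f → 𝟙 (injective? f))) ⟩
  #injections n m * (m ∸ n) * (m ∸ suc n) !
    ≡⟨ *-assoc (#injections n m) (m ∸ n) ((m ∸ suc n) !) ⟩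
  #injections n m * ((m ∸ n) * (m ∸ suc n) !)
    -- Because `n < m`, the truncated difference `m ∸ n` is the successor of `m ∸ suc n`.
    ≡⟨ cong (#injections n m *_) (fact-step (sym (+-∸-assoc 1 n<m))) ⟩
  #injections n m * (m ∸ n) !
    ≤⟨ #injections-bound n m (<⇒≤ n<m) ⟩
  m ! ∎
  where
  open ≤-Reasoning
  fact-step : ∀ {a b} → suc b ≡ a → a * b ! ≡ a !
  fact-step refl = refl

#labellings≤n! : (n : ℕ) → length (labellings n) ≤ n !
#labellings≤n! n = begin
  length (labellings n)       ≡⟨ length-filterᵇ isInjectiveᵇ (allFuns n n) ⟩
  #injections n n             ≡⟨ *-identityʳ _ ⟨
  #injections n n * 1         ≡⟨ cong (λ k → #injections n n * k !) (n∸n≡0 n) ⟨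
  #injections n n * (n ∸ n) ! ≤⟨ #injections-bound n n ≤-refl ⟩
  n !                         ∎
  where open ≤-Reasoning

-- Vertex subsets and their cardinality.

Subset : ℕ → Set
Subset n = Fin n → Bool

-- The disjuncts stand in the same order as in `inClosedNbr`, so `insert v (arc G v)` computes to
-- `inClosedNbr G v`.
insert : Fin n → Subset n → Subset n
insert z S w = (w == z) ∨ S w

∈-insertˡ : (z : Fin n) (S : Subset n) → T (insert z S z)
∈-insertˡ z S = Equivalence.from T-∨ (inj₁ (fromWitness {a? = z ≟ z} refl))

∈-insertʳ : (z : Fin n) (S : Subset n) {w : Fin n} → T (S w) → T (insert z S w)
∈-insertʳ z S {w} w∈S = Equivalence.from (T-∨ {w == z}) (inj₂ w∈S)

∈-insert⁻ : (z : Fin n) (S : Subset n) {w : Fin n} → T (insert z S w) → w ≡ z ⊎ T (S w)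
∈-insert⁻ z S {w} w∈ with Equivalence.to (T-∨ {w == z}) w∈
... | inj₁ w==z = inj₁ (toWitness w==z)
... | inj₂ w∈S  = inj₂ w∈S

card : Subset n → ℕ
card {n} S = ∑[ w ← allFin n ] 𝟙 (T? (S w))

card-insert : (z : Fin n) (S : Subset n) → ¬ T (S z) → card (insert z S) ≡ suc (card S)
card-insert {n} z S z∉S = begin
  card (insert z S)
    ≡⟨ ∑-cong (allFin n) split ⟩
  (∑[ w ← allFin n ] (𝟙 (z ≟ w) + 𝟙 (T? (S w))))
    ≡⟨ ∑-+ (allFin n) _ _ ⟩
  (∑[ w ← allFin n ] 𝟙 (z ≟ w)) + card S
    ≡⟨ cong (_+ card S) (∑-unique (z ≟_) z refl (λ _ eq → eq)) ⟩
  suc (card S) ∎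
  where
  open ≡-Reasoning
  split : ∀ w → 𝟙 (T? (insert z S w)) ≡ 𝟙 (z ≟ w) + 𝟙 (T? (S w))
  split w with z ≟ w
  ... | yes refl = trans (𝟙-yes (T? (insert z S z)) (∈-insertˡ z S))
                         (cong suc (sym (𝟙-no (T? (S z)) z∉S)))
  ... | no z≢w   = 𝟙-cong (T? (insert z S w)) (T? (S w)) from-insert (∈-insertʳ z S)
    where
    from-insert : T (insert z S w) → T (S w)
    from-insert w∈ with ∈-insert⁻ z S w∈
    ... | inj₁ w≡z = contradiction (sym w≡z) z≢w
    ... | inj₂ w∈S = w∈S

-- Minimisers of a labelling on a subset.

IsMin : Subset n → (Fin n → Fin m) → Fin n → Set
IsMin S L u = T (S u) × (∀ w → T (S w) → toℕ (L u) ≤ toℕ (L w))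

isMin? : (S : Subset n) (L : Fin n → Fin m) (u : Fin n) → Dec (IsMin S L u)
isMin? S L u = T? (S u) ×-dec all? (λ w → T? (S w) →-dec (toℕ (L u) ≤? toℕ (L w)))

IsMin-unique : {S : Subset n} {L : Fin n → Fin m} → Injective L →
               ∀ {u w} → IsMin S L u → IsMin S L w → u ≡ w
IsMin-unique inj (u∈S , u≤) (w∈S , w≤) =
  inj _ _ (Finₚ.toℕ-injective (≤-antisym (u≤ _ w∈S) (w≤ _ u∈S)))

-- The fold defining `r`, with the set and the list left free for induction; `r G L v` is the
-- instance `inClosedNbr G v`, `allFin n`.
argmin : Subset n → (Fin n → Fin m) → Fin n → List (Fin n) → Fin n
argmin S L v = foldr (λ w b → if S w ∧ (toℕ (L w) <ᵇ toℕ (L b)) then w else b) v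

-- The start value lies in `S`, and a replacement happens only inside `S` and lowers the label, so
-- bounds already established persist.
argmin-spec : (S : Subset n) (L : Fin n → Fin m) (v : Fin n) → T (S v) → (xs : List (Fin n)) →
              T (S (argmin S L v xs)) ×
              All (λ w → T (S w) → toℕ (L (argmin S L v xs)) ≤ toℕ (L w)) xs
argmin-spec S L v v∈S []       = v∈S , []
argmin-spec S L v v∈S (w ∷ xs)
  with argmin S L v xs | argmin-spec S L v v∈S xs
... | b | b∈S , b≤ with S w in w∈S
...   | false = b∈S , (λ w∈ → ⊥-elim (subst T w∈S w∈)) ∷ b≤
...   | true with toℕ (L w) <ᵇ toℕ (L b) in w<b
...     | true  = subst T (sym w∈S) tt
                , (λ _ → ≤-refl)
                ∷ All.map (λ b≤x x∈S → ≤-trans (<⇒≤ (<ᵇ⇒< _ _ (subst T (sym w<b) tt))) (b≤x x∈S)) b≤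
...     | false = b∈S , (λ _ → ≮⇒≥ (λ lt → subst T w<b (<⇒<ᵇ lt))) ∷ b≤

argmin-isMin : (S : Subset n) (L : Fin n → Fin m) {v : Fin n} → T (S v) →
               IsMin S L (argmin S L v (allFin n))
argmin-isMin {n} S L {v} v∈S =
  let b∈S , b≤ = argmin-spec S L v v∈S (allFin n)
  in  b∈S , λ w → All.lookup b≤ (∈-allFin w)

transpose-∈ : (S : Subset n) {u v : Fin n} → T (S u) → T (S v) →
              ∀ {w} → T (S w) → T (S (transpose u v w))
transpose-∈ S {u} {v} u∈S v∈S {w} w∈S with w ≟ u
... | yes _ = v∈S
... | no  _ with w ≟ v
...   | yes _ = u∈S
...   | no  _ = w∈S

transpose-second : (u v : Fin n) → transpose u v v ≡ u
transpose-second u v with v ≟ u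
... | yes v≡u = v≡u
... | no  _   with v ≟ v
...   | yes _  = refl
...   | no v≢v = contradiction refl v≢v

-- Probability of being the minimiser.

#min : Subset n → Fin n → ℕ
#min {n} S u = ∑[ L ← labellings n ] 𝟙 (isMin? S L u)

-- Composing with the transposition of `u` and `v` permutes the labellings, maps `S` to itself and
-- moves the minimum from `u` to `v`.
#min-symmetric : (S : Subset n) {u v : Fin n} → T (S u) → T (S v) → #min S u ≡ #min S v
#min-symmetric {n} S {u} {v} u∈S v∈S = begin
  (∑[ L ← labellings n ] 𝟙 (isMin? S L u))
    ≡⟨ ∑-cong (labellings n) (λ L → 𝟙-cong (isMin? S L u) (isMin? S (L ∘ transpose u v) v)
         (to L) (from L)) ⟩
  (∑[ L ← labellings n ] 𝟙 (isMin? S (L ∘ transpose u v) v))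
    ≡⟨ ∑-labellings-reindex (transpose u v) (transpose v u)
         (λ _ → transpose-inverse u v) (λ _ → transpose-inverse v u)
         (λ {f} {g} f≗g → 𝟙-cong (isMin? S f v) (isMin? S g v)
           (IsMin-resp f≗g) (IsMin-resp (sym ∘ f≗g))) ⟩
  (∑[ L ← labellings n ] 𝟙 (isMin? S L v)) ∎
  where
  open ≡-Reasoning
  τ = transpose u v
  to : ∀ L → IsMin S L u → IsMin S (L ∘ τ) v
  to L (_ , u≤) = v∈S , λ w w∈S →
    subst (λ x → toℕ (L x) ≤ toℕ (L (τ w))) (sym (transpose-second u v))
      (u≤ _ (transpose-∈ S u∈S v∈S w∈S))
  from : ∀ L → IsMin S (L ∘ τ) v → IsMin S L u
  from L (_ , v≤) = u∈S , λ w w∈S →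
    subst (λ x → toℕ (L u) ≤ toℕ (L x)) (transpose-inverse u v)
      (subst (λ x → toℕ (L x) ≤ toℕ (L (τ (transpose v u w)))) (transpose-second u v)
        (v≤ _ (transpose-∈ S v∈S u∈S w∈S)))
  IsMin-resp : {f g : Fin n → Fin n} → f ≗ g → IsMin S f v → IsMin S g v
  IsMin-resp f≗g (v∈S , v≤) =
    v∈S , λ w w∈S → subst (λ x → toℕ x ≤ _) (f≗g v) (subst (λ x → _ ≤ toℕ x) (f≗g w) (v≤ w w∈S))

-- The probability 1/|S|: every labelling has exactly one minimiser on `S`, and by symmetry all
-- members of `S` are equally likely.
card*#min : (S : Subset n) {u : Fin n} → T (S u) → card S * #min S u ≡ length (labellings n)
card*#min {n} S {u} u∈S = begin
  card S * #min S u
    ≡⟨ ∑-*ʳ (allFin n) (#min S u) (λ w → 𝟙 (T? (S w))) ⟨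
  (∑[ w ← allFin n ] (𝟙 (T? (S w)) * #min S u))
    ≡⟨ ∑-cong (allFin n) same ⟩
  (∑[ w ← allFin n ] #min S w)
    ≡⟨ ∑-swap (allFin n) (labellings n) (λ w L → 𝟙 (isMin? S L w)) ⟩
  (∑[ L ← labellings n ] ∑[ w ← allFin n ] 𝟙 (isMin? S L w))
    ≡⟨ ∑-cong-All (All.map (λ {L} inj → ∑-unique (isMin? S L) _ (argmin-isMin S L u∈S)
         (λ w → IsMin-unique {S = S} {L} inj (argmin-isMin S L u∈S))) (labellings-injective n)) ⟩
  (∑[ L ← labellings n ] 1)
    ≡⟨ trans (∑-const (labellings n) 1) (*-identityʳ _) ⟩
  length (labellings n) ∎
  where
  open ≡-Reasoning
  same : ∀ w → 𝟙 (T? (S w)) * #min S u ≡ #min S w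
  same w with T? (S w)
  ... | yes w∈S = trans (cong (_* #min S u) (𝟙-yes (T? (S w)) w∈S))
                        (trans (*-identityˡ (#min S u)) (#min-symmetric S u∈S w∈S))
  ... | no w∉S  = trans (cong (_* #min S u) (𝟙-no (T? (S w)) w∉S))
                        (sym (trans (∑-cong (labellings n) (λ L → 𝟙-no (isMin? S L w) (w∉S ∘ proj₁)))
                                    (∑-zero (labellings n))))

-- The complementary event is that `w` is minimal in the pair of `z` and `w`, which has probability
-- 1/2.
#below-of-distinct : (z w : Fin n) → w ≢ z →
  2 * (∑[ L ← labellings n ] 𝟙 (toℕ (L z) <? toℕ (L w))) ≡ length (labellings n)
#below-of-distinct {n} z w w≢z = +-cancelʳ-≡ N _ _ (begin
  2 * below + N
    ≡⟨ cong (2 * below +_) (trans (cong (_* #min pair w) (sym card-pair)) (card*#min pair w∈pair)) ⟨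
  2 * below + 2 * #min pair w
    ≡⟨ *-distribˡ-+ 2 below (#min pair w) ⟨
  2 * (below + #min pair w)
    ≡⟨ cong (2 *_) (∑-+ (labellings n) _ _) ⟨
  2 * (∑[ L ← labellings n ] (𝟙 (toℕ (L z) <? toℕ (L w)) + 𝟙 (isMin? pair L w)))
    ≡⟨ cong (2 *_) (trans (∑-cong (labellings n) complementary) (∑-const (labellings n) 1)) ⟩
  2 * (N * 1)
    ≡⟨ double N ⟩
  N + N ∎)
  where
  open ≡-Reasoning
  N = length (labellings n)
  below = ∑[ L ← labellings n ] 𝟙 (toℕ (L z) <? toℕ (L w))
  ∅ : Subset n
  ∅ _ = false
  pair = insert z (insert w ∅)
  w∈pair : T (pair w)
  w∈pair = ∈-insertʳ z (insert w ∅) (∈-insertˡ w ∅)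
  z∉w : ¬ T (insert w ∅ z)
  z∉w z∈ with ∈-insert⁻ w ∅ {z} z∈
  ... | inj₁ z≡w = w≢z (sym z≡w)
  card-pair : card pair ≡ 2
  card-pair = trans (card-insert z (insert w ∅) z∉w)
    (cong suc (trans (card-insert w ∅ (λ ())) (cong suc (∑-zero (allFin n)))))
  complementary : ∀ L → 𝟙 (toℕ (L z) <? toℕ (L w)) + 𝟙 (isMin? pair L w) ≡ 1
  complementary L with toℕ (L z) <? toℕ (L w)
  ... | yes z<w = cong₂ _+_
    (𝟙-yes (toℕ (L z) <? toℕ (L w)) z<w)
    (𝟙-no (isMin? pair L w) (λ { (_ , w≤) → <⇒≱ z<w (w≤ z (∈-insertˡ z (insert w ∅))) }))
  ... | no z≮w = cong₂ _+_
    (𝟙-no (toℕ (L z) <? toℕ (L w)) z≮w)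
    (𝟙-yes (isMin? pair L w) (w∈pair , w≤))
    where
    w≤ : ∀ x → T (pair x) → toℕ (L w) ≤ toℕ (L x)
    w≤ x x∈ with ∈-insert⁻ z (insert w ∅) {x} x∈
    ... | inj₁ refl = ≮⇒≥ z≮w
    ... | inj₂ x∈w with ∈-insert⁻ w ∅ {x} x∈w
    ...   | inj₁ refl = ≤-refl
  double : ∀ a → 2 * (a * 1) ≡ a + a
  double = solve-∀

minAbove? : (S : Subset n) (z u : Fin n) (L : Fin n → Fin n) →
            Dec (IsMin S L u × toℕ (L z) < toℕ (L u))
minAbove? S z u L = isMin? S L u ×-dec (toℕ (L z) <? toℕ (L u))

-- For z ∉ S the probability is 1/|S| − 1/(|S|+1): u is minimal in S but not in S ∪ {z}.
#minAbove-bound : (S : Subset n) (z : Fin n) {u : Fin n} → T (S u) →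
  card S * suc (card S) * (∑[ L ← labellings n ] 𝟙 (minAbove? S z u L)) ≤ length (labellings n)
#minAbove-bound {n} S z {u} u∈S with T? (S z)
-- A member of `S` cannot lie below the minimiser of `S`, so the count is zero.
... | yes z∈S = ≤-trans
  (≤-reflexive (trans
    (cong (card S * suc (card S) *_)
      (trans (∑-cong (labellings n) (λ L → 𝟙-no (minAbove? S z u L)
               (λ { ((_ , u≤) , z<u) → <⇒≱ z<u (u≤ z z∈S) })))
             (∑-zero (labellings n))))
    (*-zeroʳ (card S * suc (card S)))))
  z≤n
-- Adding `c * N` to both sides avoids the subtraction in 1/c - 1/(c+1).
... | no z∉S = ≤-reflexive (+-cancelʳ-≡ (c * N) _ _ (begin
  c * suc c * above + c * N
    ≡⟨ cong (λ k → c * suc c * above + c * k) card*#min′ ⟨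
  c * suc c * above + c * (suc c * #min S′ u)
    ≡⟨ factor c above (#min S′ u) ⟩
  suc c * (c * (above + #min S′ u))
    ≡⟨ cong (λ k → suc c * (c * k)) (trans (sym (∑-+ (labellings n) _ _)) (∑-cong (labellings n) split)) ⟩
  suc c * (c * #min S u)
    ≡⟨ cong (suc c *_) (card*#min S u∈S) ⟩
  N + c * N ∎))
  where
  open ≡-Reasoning
  N = length (labellings n)
  c = card S
  S′ = insert z S
  above = ∑[ L ← labellings n ] 𝟙 (minAbove? S z u L)
  factor : ∀ c a b → c * suc c * a + c * (suc c * b) ≡ suc c * (c * (a + b))
  factor = solve-∀
  card*#min′ : suc c * #min S′ u ≡ N
  card*#min′ = trans (cong (_* #min S′ u) (sym (card-insert z S z∉S)))
                     (card*#min S′ (∈-insertʳ z S u∈S))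
  -- A minimiser of `S` either has `z` strictly below it or stays minimal once `z` is inserted.
  split : ∀ L → 𝟙 (minAbove? S z u L) + 𝟙 (isMin? S′ L u) ≡ 𝟙 (isMin? S L u)
  split L with toℕ (L z) <? toℕ (L u)
  ... | yes z<u = trans
    (cong₂ _+_
      (𝟙-cong (minAbove? S z u L) (isMin? S L u) proj₁ (_, z<u))
      (𝟙-no (isMin? S′ L u) (λ { (_ , u≤) → <⇒≱ z<u (u≤ z (∈-insertˡ z S)) })))
    (+-identityʳ _)
  ... | no z≮u = cong₂ _+_
    (𝟙-no (minAbove? S z u L) (z≮u ∘ proj₂))
    (𝟙-cong (isMin? S′ L u) (isMin? S L u)
      (λ { (_ , u≤) → u∈S , λ w w∈S → u≤ w (∈-insertʳ z S w∈S) })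
      (λ { (_ , u≤) → ∈-insertʳ z S u∈S , λ w w∈S′ → below w (u≤ w) (∈-insert⁻ z S {w} w∈S′) }))
    where
    below : ∀ w → (T (S w) → toℕ (L u) ≤ toℕ (L w)) → w ≡ z ⊎ T (S w) → toℕ (L u) ≤ toℕ (L w)
    below w u≤ (inj₁ refl) = ≮⇒≥ z≮u
    below w u≤ (inj₂ w∈S)  = u≤ w∈S

-- (d − 1)(d − 2) ≥ 0 on the naturals.
6d≤[1+d][2+d] : ∀ d → 6 * d ≤ suc d * suc (suc d)
6d≤[1+d][2+d] zero          = z≤n
6d≤[1+d][2+d] (suc zero)    = ≤-refl
6d≤[1+d][2+d] (suc (suc e)) = ≤-trans (m≤m+n _ (e + e * e)) (≤-reflexive (expand e))
  where
  expand : ∀ e → 6 * suc (suc e) + (e + e * e) ≡ suc (suc (suc e)) * suc (suc (suc (suc e)))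
  expand = solve-∀

-- Bounding the image of `r` in a digraph.

module _ {n} (G : Digraph n) (loopless : Loopless G) (outNonempty : OutNonempty G) where

  private
    N = length (labellings n)

    f : Fin n → Fin n
    f = proj₁ ∘ outNonempty

    arc-f : ∀ w → T (arc G w (f w))
    arc-f w = subst T (sym (proj₂ (outNonempty w))) tt

    no-loop : ∀ v → ¬ T (arc G v v)
    no-loop v = subst T (loopless v)

    w≢fw : ∀ w → w ≢ f w
    w≢fw w w≡fw = no-loop w (subst (T ∘ arc G w) (sym w≡fw) (arc-f w))

    bad? : (v w : Fin n) (L : Fin n → Fin n) → Dec _
    bad? v w L = T? (arc G v w) ×-dec minAbove? (inClosedNbr G v) (f w) w L

    below? : (w : Fin n) (L : Fin n → Fin n) → Dec _
    below? w L = toℕ (L (f w)) <? toℕ (L w)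

    inImageᵇ : (L : Fin n → Fin n) → Fin n → Bool
    inImageᵇ L w = any (λ v → r G L v == w) (allFin n)

  -- Only the case where both events on the left occur is in question; then the vertex `v` that
  -- picks `w` supplies a bad pair.
  image+below≤1+bad : ∀ L w → 𝟙 (T? (inImageᵇ L w)) + 𝟙 (below? w L) ≤
                              1 + (∑[ v ← allFin n ] 𝟙 (bad? v w L))
  image+below≤1+bad L w with T? (inImageᵇ L w)
  ... | no w∉ = ≤-trans (+-mono-≤ (≤-reflexive (𝟙-no (T? (inImageᵇ L w)) w∉)) (𝟙≤1 (below? w L)))
                        (m≤m+n 1 _)
  ... | yes w∈ with below? w L
  ...   | no fw≮w = ≤-trans (+-mono-≤ (𝟙≤1 (T? (inImageᵇ L w))) (≤-reflexive (𝟙-no (below? w L) fw≮w)))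
                            (m≤m+n 1 _)
  ...   | yes fw<w = +-mono-≤ (𝟙≤1 (T? (inImageᵇ L w))) (≤-trans (𝟙≤1 (below? w L)) (bad-exists (find (any⁻ _ (allFin n) w∈))))
    where
    bad-exists : (∃ λ v → v ∈ allFin n × T (r G L v == w)) → 1 ≤ (∑[ v ← allFin n ] 𝟙 (bad? v w L))
    bad-exists (v , v∈ , rv==w) = ≤-trans
      (≤-reflexive (sym (𝟙-yes (bad? v w L) (vw∈A , w-min , fw<w))))
      (∑-∈ (λ v → 𝟙 (bad? v w L)) v∈)
      where
      w-min : IsMin (inClosedNbr G v) L w
      w-min = subst (IsMin (inClosedNbr G v) L) (toWitness rv==w)
                (argmin-isMin (inClosedNbr G v) L (∈-insertˡ v (arc G v)))
      vw∈A : T (arc G v w)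
      vw∈A with ∈-insert⁻ v (arc G v) {w} (proj₁ w-min)
      -- A vertex does not pick itself when `f w`, a member of its closed neighbourhood, has a
      -- smaller label.
      ... | inj₁ refl = contradiction (proj₂ w-min (f w) (∈-insertʳ w (arc G w) (arc-f w))) (<⇒≱ fw<w)
      ... | inj₂ vw   = vw

  -- Multiplying through by (d+1)(d+2) keeps the estimate in the naturals: only the `d`
  -- out-neighbours contribute, each at most `N` after this scaling.
  6*#bad≤N : ∀ v → 6 * (∑[ w ← allFin n ] ∑[ L ← labellings n ] 𝟙 (bad? v w L)) ≤ N
  6*#bad≤N v = *-cancelˡ-≤ (suc d * suc (suc d)) (begin
    suc d * suc (suc d) * (6 * #bad)
      ≡⟨ swap-6 (suc d * suc (suc d)) #bad ⟩
    6 * (suc d * suc (suc d) * #bad)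
      ≡⟨ cong (6 *_) (∑-*ˡ (allFin n) (suc d * suc (suc d)) _) ⟨
    6 * (∑[ w ← allFin n ] (suc d * suc (suc d) * (∑[ L ← labellings n ] 𝟙 (bad? v w L))))
      ≤⟨ *-monoʳ-≤ 6 (∑-mono (allFin n) each) ⟩
    6 * (∑[ w ← allFin n ] (𝟙 (T? (arc G v w)) * N))
      ≡⟨ cong (6 *_) (∑-*ʳ (allFin n) N _) ⟩
    6 * (d * N)
      ≡⟨ *-assoc 6 d N ⟨
    6 * d * N
      ≤⟨ *-monoˡ-≤ N (6d≤[1+d][2+d] d) ⟩
    suc d * suc (suc d) * N ∎)
    where
    open ≤-Reasoning
    d = card (arc G v)
    #bad = ∑[ w ← allFin n ] ∑[ L ← labellings n ] 𝟙 (bad? v w L)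
    swap-6 : ∀ a b → a * (6 * b) ≡ 6 * (a * b)
    swap-6 = solve-∀
    each : ∀ w → suc d * suc (suc d) * (∑[ L ← labellings n ] 𝟙 (bad? v w L)) ≤ 𝟙 (T? (arc G v w)) * N
    each w with T? (arc G v w)
    ... | no ¬vw = ≤-trans
      (≤-reflexive (trans
        (cong (suc d * suc (suc d) *_)
          (trans (∑-cong (labellings n) (λ L → 𝟙-no (bad? v w L) (¬vw ∘ proj₁))) (∑-zero (labellings n))))
        (*-zeroʳ (suc d * suc (suc d)))))
      z≤n
    ... | yes vw = begin
      suc d * suc (suc d) * (∑[ L ← labellings n ] 𝟙 (bad? v w L))
        ≡⟨ cong (suc d * suc (suc d) *_) (∑-cong (labellings n) (λ L →
             𝟙-cong (bad? v w L) (minAbove? (inClosedNbr G v) (f w) w L) proj₂ (vw ,_))) ⟩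
      suc d * suc (suc d) * (∑[ L ← labellings n ] 𝟙 (minAbove? (inClosedNbr G v) (f w) w L))
        -- Looplessness makes the closed neighbourhood have exactly `suc d` elements.
        ≡⟨ cong (λ c → c * suc c * (∑[ L ← labellings n ] 𝟙 (minAbove? (inClosedNbr G v) (f w) w L)))
             (card-insert v (arc G v) (no-loop v)) ⟨
      card (inClosedNbr G v) * suc (card (inClosedNbr G v)) *
        (∑[ L ← labellings n ] 𝟙 (minAbove? (inClosedNbr G v) (f w) w L))
        ≤⟨ #minAbove-bound (inClosedNbr G v) (f w) (∈-insertʳ v (arc G v) vw) ⟩
      N
        ≡⟨ *-identityˡ N ⟨
      1 * N
        ≡⟨ cong (_* N) (𝟙-yes (T? (arc G v w)) vw) ⟨
      𝟙 (T? (arc G v w)) * N ∎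

  -- Here `N` is the length of the enumeration of labellings. It occurs only on the larger side, so
  -- an upper bound for it gives the bound with `n !`.
  3*totalImage≤2*n*N : 3 * totalImage G ≤ 2 * n * N
  3*totalImage≤2*n*N = combine total #below #bad n N summed 2*#below 6*#bad
    where
    open ≤-Reasoning
    total = totalImage G
    #below = ∑[ L ← labellings n ] ∑[ w ← allFin n ] 𝟙 (below? w L)
    #bad = ∑[ L ← labellings n ] ∑[ w ← allFin n ] ∑[ v ← allFin n ] 𝟙 (bad? v w L)

    summed : total + #below ≤ n * N + #bad
    summed = begin
      total + #below
        ≡⟨ ∑-+ (labellings n) (imageSize G) _ ⟨
      (∑[ L ← labellings n ] (imageSize G L + (∑[ w ← allFin n ] 𝟙 (below? w L))))
        ≤⟨ ∑-mono (labellings n) per-labelling ⟩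
      (∑[ L ← labellings n ] (n * 1 + (∑[ w ← allFin n ] ∑[ v ← allFin n ] 𝟙 (bad? v w L))))
        ≡⟨ ∑-+ (labellings n) (λ _ → n * 1) _ ⟩
      (∑[ L ← labellings n ] (n * 1)) + #bad
        ≡⟨ cong (_+ #bad) (trans (∑-const (labellings n) (n * 1))
             (trans (cong (N *_) (*-identityʳ n)) (*-comm N n))) ⟩
      n * N + #bad ∎
      where
      per-labelling : ∀ L → imageSize G L + (∑[ w ← allFin n ] 𝟙 (below? w L)) ≤
                            n * 1 + (∑[ w ← allFin n ] ∑[ v ← allFin n ] 𝟙 (bad? v w L))
      per-labelling L = begin
        imageSize G L + (∑[ w ← allFin n ] 𝟙 (below? w L))
          ≡⟨ cong (_+ (∑[ w ← allFin n ] 𝟙 (below? w L))) (length-filterᵇ (inImageᵇ L) (allFin n)) ⟩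
        (∑[ w ← allFin n ] 𝟙 (T? (inImageᵇ L w))) + (∑[ w ← allFin n ] 𝟙 (below? w L))
          ≡⟨ ∑-+ (allFin n) _ _ ⟨
        (∑[ w ← allFin n ] (𝟙 (T? (inImageᵇ L w)) + 𝟙 (below? w L)))
          ≤⟨ ∑-mono (allFin n) (image+below≤1+bad L) ⟩
        (∑[ w ← allFin n ] (1 + (∑[ v ← allFin n ] 𝟙 (bad? v w L))))
          ≡⟨ ∑-+ (allFin n) (λ _ → 1) _ ⟩
        (∑[ w ← allFin n ] 1) + (∑[ w ← allFin n ] ∑[ v ← allFin n ] 𝟙 (bad? v w L))
          ≡⟨ cong (_+ (∑[ w ← allFin n ] ∑[ v ← allFin n ] 𝟙 (bad? v w L))) (∑-allFin-const {n} 1) ⟩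
        n * 1 + (∑[ w ← allFin n ] ∑[ v ← allFin n ] 𝟙 (bad? v w L)) ∎

    2*#below : 2 * #below ≡ n * N
    2*#below = begin-equality
      2 * #below
        ≡⟨ cong (2 *_) (∑-swap (labellings n) (allFin n) (λ L w → 𝟙 (below? w L))) ⟩
      2 * (∑[ w ← allFin n ] ∑[ L ← labellings n ] 𝟙 (below? w L))
        ≡⟨ ∑-*ˡ (allFin n) 2 _ ⟨
      (∑[ w ← allFin n ] (2 * (∑[ L ← labellings n ] 𝟙 (below? w L))))
        -- Looplessness again: `f w` differs from `w`, so each order of the two labels has
        -- probability 1/2.
        ≡⟨ ∑-cong (allFin n) (λ w → #below-of-distinct (f w) w (w≢fw w)) ⟩
      (∑[ w ← allFin n ] N)
        ≡⟨ ∑-allFin-const {n} N ⟩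
      n * N ∎

    6*#bad : 6 * #bad ≤ n * N
    6*#bad = begin
      6 * #bad
        ≡⟨ cong (6 *_) (∑-cong (labellings n) (λ L →
             ∑-swap (allFin n) (allFin n) (λ w v → 𝟙 (bad? v w L)))) ⟩
      6 * (∑[ L ← labellings n ] ∑[ v ← allFin n ] ∑[ w ← allFin n ] 𝟙 (bad? v w L))
        ≡⟨ cong (6 *_) (∑-swap (labellings n) (allFin n) _) ⟩
      6 * (∑[ v ← allFin n ] ∑[ L ← labellings n ] ∑[ w ← allFin n ] 𝟙 (bad? v w L))
        ≡⟨ cong (6 *_) (∑-cong (allFin n) (λ v →
             ∑-swap (labellings n) (allFin n) (λ L w → 𝟙 (bad? v w L)))) ⟩
      6 * (∑[ v ← allFin n ] ∑[ w ← allFin n ] ∑[ L ← labellings n ] 𝟙 (bad? v w L))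
        ≡⟨ ∑-*ˡ (allFin n) 6 _ ⟨
      (∑[ v ← allFin n ] (6 * (∑[ w ← allFin n ] ∑[ L ← labellings n ] 𝟙 (bad? v w L))))
        ≤⟨ ∑-mono (allFin n) 6*#bad≤N ⟩
      (∑[ v ← allFin n ] N)
        ≡⟨ ∑-allFin-const {n} N ⟩
      n * N ∎

    -- This is 1 - 1/2 + 1/6 = 2/3, scaled by 6; the term `3 * (n * N)`, equal to `6 * b`, is added
    -- to both sides instead of subtracting `b`.
    combine : ∀ t b e n N → t + b ≤ n * N + e → 2 * b ≡ n * N → 6 * e ≤ n * N → 3 * t ≤ 2 * n * N
    combine t b e n N t+b≤ 2b≡ 6e≤ = *-cancelˡ-≤ 2 (+-cancelʳ-≤ (3 * (n * N)) _ _ (begin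
      2 * (3 * t) + 3 * (n * N)         ≡⟨ cong (λ k → 2 * (3 * t) + 3 * k) 2b≡ ⟨
      2 * (3 * t) + 3 * (2 * b)         ≡⟨ collect t b ⟩
      6 * (t + b)                       ≤⟨ *-monoʳ-≤ 6 t+b≤ ⟩
      6 * (n * N + e)                   ≡⟨ *-distribˡ-+ 6 (n * N) e ⟩
      6 * (n * N) + 6 * e               ≤⟨ +-monoʳ-≤ (6 * (n * N)) 6e≤ ⟩
      6 * (n * N) + n * N               ≡⟨ expand n N ⟩
      2 * (2 * n * N) + 3 * (n * N)     ∎))
      where
      collect : ∀ t b → 2 * (3 * t) + 3 * (2 * b) ≡ 6 * (t + b)
      collect = solve-∀
      expand : ∀ n N → 6 * (n * N) + n * N ≡ 2 * (2 * n * N) + 3 * (n * N)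
      expand = solve-∀

theorem2 : ((n : ℕ) (G : Digraph n) → Loopless G → OutNonempty G →
    3 * totalImage G ≤ 2 * n * (n !))
    × (3 * totalImage cycle3 ≡ 2 * 3 * (3 !))
theorem2 = (λ n G loopless outNonempty → ≤-trans
               (3*totalImage≤2*n*N G loopless outNonempty)
               (*-monoʳ-≤ (2 * n) (#labellings≤n! n)))
         -- Settled by evaluation: each of the six labellings of the 3-cycle has an image of size 2,
         -- so both sides are 36.
         , refl
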